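{- Computability is stable over the structure $\langle\mathbb{Q},+,-,\times,/\rangle$ of the rational numbers with addition, subtraction, multiplication and division.
   Context: Computability over natural numbers is the usual one. A set $A \subseteq \mathbb{N}$ is effectively enumerable if it is empty or the image of a total computable function from $\mathbb{N}$ to $\mathbb{N}$. For $A \subseteq \mathbb{N}^m$ and $B \subseteq \mathbb{N}$, a computable function from $A$ to $B$ is a partial computable function that is defined at every element of $A$ and takes values in $B$ there. Indexing: an indexing of a set $E$ is a partial function $i$ from $\mathbb{N}$ to $E$ such that $dom(i)$ is effectively enumerable, $i$ is surjective, and there is a computable function $eq$ from $dom(i)\times dom(i)$ to $\{0,1\}$ with $eq(x,y)=1$ if $i(x)=i(y)$ and $eq(x,y)=0$ otherwise. An indexing $i$ of the set $E$ is an admissible indexing of a one-sorted structure $\langle E,op_1,\ldots,op_p\rangle$ if every operation $op: E^m\to E$ among $op_1,\ldots,op_p$ is computable relatively to $i$, that is, there is a computable function $\hat{op}$ from $dom(i)^m$ to $dom(i)$ such that $i(\hat{op}(x_1,\ldots,x_m)) = op(i(x_1),\ldots,i(x_m))$ for all $x_1,\ldots,x_m\in dom(i)$. Division $a/b$ is a partial operation, defined for $b\neq 0$; for it, the condition is required only for arguments $x_1,x_2$ with $i(x_2)\neq 0$. Computability is stable over $\langle E,op_1,\ldots,op_p\rangle$ if there exists an admissible indexing of this structure and, for all admissible indexings $j$ and $j'$ of it, there exists a computable function $h$ from $dom(j')$ to $dom(j)$ such that $j' = j\circ h$. -}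

module Defs where

open import Data.Fin using (Fin)
open import Data.List using (List; []; _∷_)
import Data.List.Relation.Unary.All as List
open import Data.Nat using (ℕ; zero; suc; _<_)
open import Data.Nat.Properties using (<-cmp; suc-injective)
open import Data.Product using (∃; ∃-syntax; _×_; _,_; proj₁; proj₂)
open import Data.Rational as ℚ using (ℚ; 0ℚ)
open import Data.Sum using (_⊎_)
open import Data.Vec using (Vec; []; _∷_; lookup)
import Data.Vec.Relation.Unary.All as Vec
open import Data.Vec.Relation.Binary.Pointwise.Inductive using (Pointwise; []; _∷_)
open import Function using (_⇔_)
open import Level using (0ℓ)
open import Relation.Binary using (tri<; tri≈; tri>)
open import Relation.Binary.PropositionalEquality using (_≡_; _≢_; refl; sym; trans; cong₂)
open import Relation.Nullary using (contradiction)
open import Relation.Unary using (Pred; U; Empty; _∈_)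

private
  variable
    m n k : ℕ
    A B E : Set

infix 4 _⇀_
infix 4 _[_]⇓_

-- A partial function is a single-valued relation; its domain need not be
-- decidable.
record _⇀_ (A B : Set) : Set₁ where
  field
    Graph        : A → B → Set
    singleValued : ∀ {x y z} → Graph x y → Graph x z → y ≡ z

  Dom : Pred A 0ℓ
  Dom x = ∃[ y ] Graph x y

open _⇀_ public

total : (A → B) → A ⇀ B
total f .Graph x y = f x ≡ y
total f .singleValued p q = trans (sym p) q

-- Partial recursive functions of n arguments.
data Rec : ℕ → Set where
  zero : Rec 0
  succ : Rec 1
  proj : Fin n → Rec n
  comp : Rec m → Vec (Rec n) m → Rec n
  prec : Rec n → Rec (suc (suc n)) → Rec (suc n)
  μ    : Rec (suc n) → Rec n

data _[_]⇓_ : Rec n → Vec ℕ n → ℕ → Set where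
  zero⇓ : zero [ [] ]⇓ 0
  succ⇓ : ∀ {x} → succ [ x ∷ [] ]⇓ suc x
  proj⇓ : ∀ {i} {xs : Vec ℕ n} → proj i [ xs ]⇓ lookup xs i
  comp⇓ : ∀ {f : Rec m} {gs : Vec (Rec n) m} {xs ys z} →
          Pointwise (λ g y → g [ xs ]⇓ y) gs ys → f [ ys ]⇓ z →
          comp f gs [ xs ]⇓ z
  precᶻ⇓ : ∀ {f : Rec n} {g xs z} →
           f [ xs ]⇓ z → prec f g [ 0 ∷ xs ]⇓ z
  precˢ⇓ : ∀ {f : Rec n} {g x xs y z} →
           prec f g [ x ∷ xs ]⇓ y → g [ x ∷ y ∷ xs ]⇓ z →
           prec f g [ suc x ∷ xs ]⇓ z
  -- The search reaches x only if f converges to a nonzero value before x.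
  μ⇓ : ∀ {f : Rec (suc n)} {xs x} →
       (∀ w → w < x → ∃[ y ] f [ w ∷ xs ]⇓ suc y) → f [ x ∷ xs ]⇓ 0 →
       μ f [ xs ]⇓ x

⇓-deterministic : ∀ {f : Rec n} {xs y z} → f [ xs ]⇓ y → f [ xs ]⇓ z → y ≡ z
⇓*-deterministic : ∀ {gs : Vec (Rec n) m} {xs ys zs} →
  Pointwise (λ g y → g [ xs ]⇓ y) gs ys →
  Pointwise (λ g y → g [ xs ]⇓ y) gs zs → ys ≡ zs

⇓-deterministic zero⇓ zero⇓ = refl
⇓-deterministic succ⇓ succ⇓ = refl
⇓-deterministic proj⇓ proj⇓ = refl
⇓-deterministic (comp⇓ ps p) (comp⇓ qs q) with refl ← ⇓*-deterministic ps qs =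
  ⇓-deterministic p q
⇓-deterministic (precᶻ⇓ p) (precᶻ⇓ q) = ⇓-deterministic p q
⇓-deterministic (precˢ⇓ p p′) (precˢ⇓ q q′) with refl ← ⇓-deterministic p q =
  ⇓-deterministic p′ q′
⇓-deterministic (μ⇓ {x = x} below p) (μ⇓ {x = x′} below′ q) with <-cmp x x′
... | tri≈ _ x≡x′ _ = x≡x′
... | tri< x<x′ _ _ = contradiction (⇓-deterministic p (proj₂ (below′ x x<x′))) λ ()
... | tri> _ _ x′<x = contradiction (⇓-deterministic q (proj₂ (below x′ x′<x))) λ ()

⇓*-deterministic []       []       = refl
⇓*-deterministic (p ∷ ps) (q ∷ qs) =
  cong₂ _∷_ (⇓-deterministic p q) (⇓*-deterministic ps qs)

⟦_⟧ : Rec n → Vec ℕ n ⇀ ℕ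
⟦ f ⟧ .Graph        = f [_]⇓_
⟦ f ⟧ .singleValued = ⇓-deterministic

infix 8 _^_
_^_ : Pred ℕ 0ℓ → (m : ℕ) → Pred (Vec ℕ m) 0ℓ
(A ^ m) = Vec.All A

-- A computable function from A to B: nothing is required outside A.
record Computable (A : Pred (Vec ℕ m) 0ℓ) (B : Pred ℕ 0ℓ) : Set where
  field
    code : Rec m
    maps : ∀ {xs} → xs ∈ A → ∃[ y ] (Graph ⟦ code ⟧ xs y × y ∈ B)

open Computable public

EffectivelyEnumerable : Pred ℕ 0ℓ → Set
EffectivelyEnumerable A =
  Empty A ⊎
  ∃[ f ] (∀ y → y ∈ A ⇔ (∃[ x ] Graph ⟦ code {A = U ^ 1} {B = U} f ⟧ (x ∷ []) y))

Bit : Pred ℕ 0ℓ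
Bit b = b ≡ 0 ⊎ b ≡ 1

record IsIndexing (i : ℕ ⇀ E) : Set where
  field
    enumerable : EffectivelyEnumerable (Dom i)
    surjective : ∀ e → ∃[ x ] Graph i x e
    eq         : Computable (Dom i ^ 2) Bit
    eq-≡       : ∀ {x y d e} → Graph i x d → Graph i y e → d ≡ e →
                 Graph ⟦ code eq ⟧ (x ∷ y ∷ []) 1
    eq-≢       : ∀ {x y d e} → Graph i x d → Graph i y e → d ≢ e →
                 Graph ⟦ code eq ⟧ (x ∷ y ∷ []) 0

-- One-sorted structures; operations may be partial.
record Structure : Set₁ where
  field
    Carrier    : Set
    operations : List (∃[ m ] (Vec Carrier m ⇀ Carrier))

open Structure public

-- The tracking function is total on tuples of indices, but the equation is
-- required only where op is defined.
record ComputableRelativelyTo (i : ℕ ⇀ E) (op : Vec E m ⇀ E) : Set where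
  field
    ôp     : Computable (Dom i ^ m) (Dom i)
    tracks : ∀ {xs es e y} → Pointwise (Graph i) xs es → Graph op es e →
             Graph ⟦ code ôp ⟧ xs y → Graph i y e

record IsAdmissible (S : Structure) (i : ℕ ⇀ Carrier S) : Set₁ where
  field
    isIndexing : IsIndexing i
    computable : List.All (λ (_ , op) → ComputableRelativelyTo i op) (operations S)

-- j′ = j ∘ h for some computable h from Dom j′ to Dom j.
_ReducesTo_ : ℕ ⇀ E → ℕ ⇀ E → Set
j′ ReducesTo j =
  ∃[ h ] (∀ {x y e} → Graph j′ x e →
          Graph ⟦ code {A = Dom j′ ^ 1} {B = Dom j} h ⟧ (x ∷ []) y → Graph j y e)

ComputabilityStable : Structure → Set₁
ComputabilityStable S =
  (∃[ i ] IsAdmissible S i) ×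
  (∀ j j′ → IsAdmissible S j → IsAdmissible S j′ → j′ ReducesTo j)

binary : (A → A → A) → Vec A 2 ⇀ A
binary _∙_ = total λ { (x ∷ y ∷ []) → x ∙ y }

division : Vec ℚ 2 ⇀ ℚ
division .Graph (a ∷ b ∷ []) c =
  ∃ λ (b≢0 : b ≢ 0ℚ) → ℚ._÷_ a b {{ℚ.≢-nonZero {b} b≢0}} ≡ c
division .singleValued {_ ∷ _ ∷ []} (_ , p) (_ , q) = trans (sym p) q

ℚ⟨+-×/⟩ : Structure
ℚ⟨+-×/⟩ .Carrier    = ℚ
ℚ⟨+-×/⟩ .operations =
  (2 , binary ℚ._+_) ∷ (2 , binary ℚ._-_) ∷ (2 , binary ℚ._*_) ∷ (2 , division) ∷ []

{-# OPTIONS --safe #-}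

-- Index (a − b) / (1 + c) by a code of the triple (a, b, c). This standard
-- indexing is admissible, and it reduces to any admissible indexing j: given
-- j-names of 0 and 1, the j-versions of +, −, / compute a j-name of
-- (a − b) / (1 + c) from (a, b, c). Conversely every admissible j′ reduces to
-- the standard indexing: enumerate the triples n, translate each into a j′-name,
-- and stop at the first that the equality test of j′ identifies with the input.
module Submission where

open import Defs

open import Data.Fin using (Fin; zero; suc)
import Data.Integer as ℤ
open import Data.Integer.Solver using () renaming (module +-*-Solver to ℤ-Solver)
open import Data.List.Relation.Unary.All as List using ([]; _∷_)
open import Data.Nat hiding (_^_)
open import Data.Nat.Properties
open import Data.Nat.Solver using () renaming (module +-*-Solver to ℕ-Solver)
open import Data.Product using (∃-syntax; _×_; _,_; proj₁; proj₂)
open import Data.Rational as ℚ using (ℚ; 0ℚ; 1ℚ)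
import Data.Rational.Properties as ℚ
open import Data.Rational.Solver using () renaming (module +-*-Solver to ℚ-Solver)
open import Algebra.Properties.Group ℚ.+-0-group using () renaming
  (∙-cancelʳ to ℚ-+-cancelʳ; x∙y⁻¹≈ε⇒x≈y to ℚ-x-y≡0⇒x≡y)
import Data.Rational.Unnormalised as ℚᵘ
import Data.Rational.Unnormalised.Properties as ℚᵘ
open import Data.Sum using (inj₁; inj₂; reduce)
open import Data.Vec using (Vec; []; _∷_; map; lookup)
open import Data.Vec.Relation.Unary.All using ([]; _∷_)
open import Data.Vec.Relation.Binary.Pointwise.Inductive using (Pointwise; []; _∷_)
open import Function using (_∘_; mk⇔)
open import Relation.Binary.PropositionalEquality
open import Relation.Nullary using (¬_; yes; no; contradiction)
open import Relation.Unary using (U; Decidable)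

private
  variable
    m n : ℕ

record TotalRec (n : ℕ) : Set where
  field
    codeOf    : Rec n
    eval      : Vec ℕ n → ℕ
    evaluates : ∀ xs → codeOf [ xs ]⇓ eval xs

open TotalRec

infixl 9 _⟨_⟩
_⟨_⟩ : TotalRec m → Vec (TotalRec n) m → TotalRec n
(f ⟨ gs ⟩) .codeOf       = comp (codeOf f) (map codeOf gs)
(f ⟨ gs ⟩) .eval xs      = eval f (map (λ g → eval g xs) gs)
(f ⟨ gs ⟩) .evaluates xs = comp⇓ (all gs) (evaluates f _)
  where
  all : ∀ {m} (gs : Vec _ m) →
        Pointwise (λ c y → c [ xs ]⇓ y) (map codeOf gs) (map (λ g → eval g xs) gs)
  all []       = []
  all (g ∷ gs) = evaluates g xs ∷ all gs

argument : Fin n → TotalRec n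
argument i .codeOf      = proj i
argument i .eval xs     = lookup xs i
argument i .evaluates _ = proj⇓

x₀ : TotalRec (suc n)
x₀ = argument zero

x₁ : TotalRec (suc (suc n))
x₁ = argument (suc zero)

constantCode : ℕ → Rec n
constantCode zero    = comp zero []
constantCode (suc k) = comp succ (constantCode k ∷ [])

constant : ℕ → TotalRec n
constant k .codeOf             = constantCode k
constant k .eval _             = k
constant zero    .evaluates _  = comp⇓ [] zero⇓
constant (suc k) .evaluates xs = comp⇓ (evaluates (constant k) xs ∷ []) succ⇓

successor : TotalRec 1
successor .codeOf                = succ
successor .eval (x ∷ [])         = suc x
successor .evaluates (x ∷ [])    = succ⇓

sum : TotalRec 2
sum .codeOf = prec (proj zero) (comp succ (proj (suc zero) ∷ []))
sum .eval (x ∷ y ∷ []) = x + y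
sum .evaluates (zero  ∷ y ∷ []) = precᶻ⇓ proj⇓
sum .evaluates (suc x ∷ y ∷ []) =
  precˢ⇓ (evaluates sum (x ∷ y ∷ [])) (comp⇓ (proj⇓ ∷ []) succ⇓)

infixl 6 _⊕_ _⊖_
infixl 7 _⊗_

_⊕_ : TotalRec n → TotalRec n → TotalRec n
f ⊕ g = sum ⟨ f ∷ g ∷ [] ⟩

product : TotalRec 2
product .codeOf =
  prec (codeOf {1} (constant 0)) (codeOf {3} (argument (suc (suc zero)) ⊕ x₁))
product .eval (x ∷ y ∷ []) = x * y
product .evaluates (zero  ∷ y ∷ []) = precᶻ⇓ (evaluates (constant 0) _)
product .evaluates (suc x ∷ y ∷ []) =
  precˢ⇓ (evaluates product (x ∷ y ∷ [])) (evaluates (argument (suc (suc zero)) ⊕ x₁) _)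

_⊗_ : TotalRec n → TotalRec n → TotalRec n
f ⊗ g = product ⟨ f ∷ g ∷ [] ⟩

predecessor : TotalRec 1
predecessor .codeOf = prec zero (proj zero)
predecessor .eval (x ∷ []) = pred x
predecessor .evaluates (zero  ∷ []) = precᶻ⇓ zero⇓
predecessor .evaluates (suc x ∷ []) =
  precˢ⇓ (evaluates predecessor (x ∷ [])) proj⇓

monusFlipped : TotalRec 2
monusFlipped .codeOf = prec (proj zero) (codeOf {3} (predecessor ⟨ x₁ ∷ [] ⟩))
monusFlipped .eval (x ∷ y ∷ []) = y ∸ x
monusFlipped .evaluates (zero  ∷ y ∷ []) = precᶻ⇓ proj⇓
monusFlipped .evaluates (suc x ∷ y ∷ []) =
  subst (codeOf monusFlipped [ suc x ∷ y ∷ [] ]⇓_) (pred[m∸n]≡m∸[1+n] y x)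
    (precˢ⇓ (evaluates monusFlipped (x ∷ y ∷ []))
            (evaluates (predecessor ⟨ x₁ ∷ [] ⟩) (x ∷ y ∸ x ∷ y ∷ [])))

_⊖_ : TotalRec n → TotalRec n → TotalRec n
f ⊖ g = monusFlipped ⟨ g ∷ f ∷ [] ⟩

distance : ℕ → ℕ → ℕ
distance x y = (x ∸ y) + (y ∸ x)

distanceᶜ : TotalRec n → TotalRec n → TotalRec n
distanceᶜ f g = (f ⊖ g) ⊕ (g ⊖ f)

root : ℕ → ℕ
root zero    = 0
root (suc n) = root n + (1 ∸ (suc (root n) * suc (root n) ∸ suc n))

rootStep : TotalRec 2
rootStep = x₁ ⊕ (constant 1 ⊖ (s+1 ⊗ s+1 ⊖ successor ⟨ x₀ ∷ [] ⟩))
  where s+1 = successor ⟨ x₁ ∷ [] ⟩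

rootᶜ : TotalRec 1
rootᶜ .codeOf                    = prec zero (codeOf rootStep)
rootᶜ .eval (n ∷ [])             = root n
rootᶜ .evaluates (zero  ∷ [])    = precᶻ⇓ zero⇓
rootᶜ .evaluates (suc n ∷ [])    =
  precˢ⇓ (evaluates rootᶜ (n ∷ [])) (evaluates rootStep (n ∷ root n ∷ []))

suc-square : ∀ s → suc s * suc s ≡ suc (s + s + s * s)
suc-square = ℕ-Solver.solve 1
  (λ s → (con 1 :+ s) :* (con 1 :+ s) := con 1 :+ (s :+ s :+ s :* s)) refl
  where open ℕ-Solver

root-square : ∀ s → root (s * s) ≡ s
root-square+ : ∀ s t → t ≤ s + s → root (t + s * s) ≡ s

root-square zero    = refl
root-square (suc s) = begin
  root (suc s * suc s)                      ≡⟨ cong root (suc-square s) ⟩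
  root (suc N)                              ≡⟨⟩
  root N + (1 ∸ (suc (root N) * suc (root N) ∸ suc N))
    ≡⟨ cong (λ r → r + (1 ∸ (suc r * suc r ∸ suc N))) (root-square+ s (s + s) ≤-refl) ⟩
  s + (1 ∸ (suc s * suc s ∸ suc N))         ≡⟨ cong (λ k → s + (1 ∸ (k ∸ suc N))) (suc-square s) ⟩
  s + (1 ∸ (suc N ∸ suc N))                 ≡⟨ cong (λ k → s + (1 ∸ k)) (n∸n≡0 N) ⟩
  s + 1                                     ≡⟨ +-comm s 1 ⟩
  suc s                                     ∎
  where
  open ≡-Reasoning
  N = s + s + s * s
root-square+ s zero    _   = root-square s
root-square+ s (suc t) t<2s = begin
  root N + (1 ∸ (suc (root N) * suc (root N) ∸ suc N))
    ≡⟨ cong (λ r → r + (1 ∸ (suc r * suc r ∸ suc N))) (root-square+ s t (<⇒≤ t<2s)) ⟩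
  s + (1 ∸ (suc s * suc s ∸ suc N))         ≡⟨ cong (s +_) (m≤n⇒m∸n≡0 (m<n⇒0<n∸m below)) ⟩
  s + 0                                     ≡⟨ +-identityʳ s ⟩
  s                                         ∎
  where
  open ≡-Reasoning
  N = t + s * s
  below : suc N < suc s * suc s
  below = subst (suc N <_) (sym (suc-square s)) (s≤s (+-monoˡ-≤ (s * s) t<2s))

opaque
  -- Not surjective, but x + y is the integer square root of the code; as left and
  -- right are total, every number still codes some pair.
  pair : ℕ → ℕ → ℕ
  pair x y = x + (x + y) * (x + y)

  left right : ℕ → ℕ
  left  p = p ∸ root p * root p
  right p = root p ∸ left p

  root-pair : ∀ x y → root (pair x y) ≡ x + y
  root-pair x y = root-square+ (x + y) x (≤-trans (m≤m+n x y) (m≤m+n (x + y) (x + y)))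

  left-pair : ∀ x y → left (pair x y) ≡ x
  left-pair x y = begin
    pair x y ∸ root (pair x y) * root (pair x y)
      ≡⟨ cong (λ r → pair x y ∸ r * r) (root-pair x y) ⟩
    x + (x + y) * (x + y) ∸ (x + y) * (x + y)
      ≡⟨ m+n∸n≡m x ((x + y) * (x + y)) ⟩
    x ∎
    where open ≡-Reasoning

  right-pair : ∀ x y → right (pair x y) ≡ y
  right-pair x y = trans (cong₂ _∸_ (root-pair x y) (left-pair x y)) (m+n∸m≡n x y)

opaque
  unfolding pair

  pairing : ∃[ f ] (∀ x y → f [ x ∷ y ∷ [] ]⇓ pair x y)
  pairing = codeOf f , λ x y → evaluates f (x ∷ y ∷ [])
    where
    f : TotalRec 2
    f = x₀ ⊕ (x₀ ⊕ x₁) ⊗ (x₀ ⊕ x₁)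

  unpairing : ∃[ f ] ∃[ g ] (∀ p → f [ p ∷ [] ]⇓ left p × g [ p ∷ [] ]⇓ right p)
  unpairing = codeOf f , codeOf g , λ p → evaluates f (p ∷ []) , evaluates g (p ∷ [])
    where
    f g : TotalRec 1
    f = x₀ ⊖ rootᶜ ⊗ rootᶜ
    g = rootᶜ ⊖ f

pairᶜ : TotalRec 2
pairᶜ .codeOf                 = proj₁ pairing
pairᶜ .eval (x ∷ y ∷ [])      = pair x y
pairᶜ .evaluates (x ∷ y ∷ []) = proj₂ pairing x y

leftᶜ rightᶜ : TotalRec 1
leftᶜ .codeOf              = proj₁ unpairing
leftᶜ .eval (p ∷ [])       = left p
leftᶜ .evaluates (p ∷ [])  = proj₁ (proj₂ (proj₂ unpairing) p)
rightᶜ .codeOf             = proj₁ (proj₂ unpairing)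
rightᶜ .eval (p ∷ [])      = right p
rightᶜ .evaluates (p ∷ []) = proj₂ (proj₂ (proj₂ unpairing) p)

⟪_⟫ : ℕ → ℚ
⟪ zero ⟫  = 0ℚ
⟪ suc k ⟫ = ⟪ k ⟫ ℚ.+ 1ℚ

⟪⟫-nonNegative : ∀ k → ℚ.NonNegative ⟪ k ⟫
⟪⟫-nonNegative zero    = _
⟪⟫-nonNegative (suc k) = ℚ.nonNeg+nonNeg⇒nonNeg ⟪ k ⟫ {{⟪⟫-nonNegative k}} 1ℚ

⟪suc⟫≢0 : ∀ k → ⟪ suc k ⟫ ≢ 0ℚ
⟪suc⟫≢0 k = ≢-sym (ℚ.<⇒≢ (ℚ.positive⁻¹ ⟪ suc k ⟫
  {{ℚ.nonNeg+pos⇒pos ⟪ k ⟫ {{⟪⟫-nonNegative k}} 1ℚ}}))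

⟪⟫-+ : ∀ m n → ⟪ m + n ⟫ ≡ ⟪ m ⟫ ℚ.+ ⟪ n ⟫
⟪⟫-+ zero    n = sym (ℚ.+-identityˡ ⟪ n ⟫)
⟪⟫-+ (suc m) n = trans (cong (ℚ._+ 1ℚ) (⟪⟫-+ m n))
  (ℚ-Solver.solve 2 (λ m n → m :+ n :+ con 1ℚ := m :+ con 1ℚ :+ n) refl ⟪ m ⟫ ⟪ n ⟫)
  where open ℚ-Solver

⟪⟫-* : ∀ m n → ⟪ m * n ⟫ ≡ ⟪ m ⟫ ℚ.* ⟪ n ⟫
⟪⟫-* zero    n = sym (ℚ.*-zeroˡ ⟪ n ⟫)
⟪⟫-* (suc m) n = begin
  ⟪ n + m * n ⟫                   ≡⟨ ⟪⟫-+ n (m * n) ⟩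
  ⟪ n ⟫ ℚ.+ ⟪ m * n ⟫             ≡⟨ cong (⟪ n ⟫ ℚ.+_) (⟪⟫-* m n) ⟩
  ⟪ n ⟫ ℚ.+ ⟪ m ⟫ ℚ.* ⟪ n ⟫
    ≡⟨ ℚ-Solver.solve 2 (λ m n → n :+ m :* n := (m :+ con 1ℚ) :* n) refl ⟪ m ⟫ ⟪ n ⟫ ⟩
  (⟪ m ⟫ ℚ.+ 1ℚ) ℚ.* ⟪ n ⟫        ∎
  where open ≡-Reasoning; open ℚ-Solver

⟪⟫-injective : ∀ m n → ⟪ m ⟫ ≡ ⟪ n ⟫ → m ≡ n
⟪⟫-injective zero    zero    _  = refl
⟪⟫-injective zero    (suc n) eq = contradiction (sym eq) (⟪suc⟫≢0 n)
⟪⟫-injective (suc m) zero    eq = contradiction eq (⟪suc⟫≢0 m)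
⟪⟫-injective (suc m) (suc n) eq =
  cong suc (⟪⟫-injective m n (ℚ-+-cancelʳ 1ℚ ⟪ m ⟫ ⟪ n ⟫ eq))

⟪⟫-+* : ∀ k l m n → ⟪ k * l + m * n ⟫ ≡ ⟪ k ⟫ ℚ.* ⟪ l ⟫ ℚ.+ ⟪ m ⟫ ℚ.* ⟪ n ⟫
⟪⟫-+* k l m n = trans (⟪⟫-+ (k * l) (m * n)) (cong₂ ℚ._+_ (⟪⟫-* k l) (⟪⟫-* m n))

infix 7 _÷_by_
_÷_by_ : ∀ p q → q ≢ 0ℚ → ℚ
p ÷ q by q≢0 = ℚ._÷_ p q {{ℚ.≢-nonZero q≢0}}

÷-* : ∀ p q (q≢0 : q ≢ 0ℚ) → (p ÷ q by q≢0) ℚ.* q ≡ p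
÷-* p q q≢0 = begin
  p ℚ.* 1/q ℚ.* q     ≡⟨ ℚ.*-assoc p 1/q q ⟩
  p ℚ.* (1/q ℚ.* q)   ≡⟨ cong (p ℚ.*_) (ℚ.*-inverseˡ q {{ℚ.≢-nonZero q≢0}}) ⟩
  p ℚ.* 1ℚ            ≡⟨ ℚ.*-identityʳ p ⟩
  p                   ∎
  where
  open ≡-Reasoning
  1/q = ℚ.1/_ q {{ℚ.≢-nonZero q≢0}}

*-cancelʳ-≢0 : ∀ p q {r} → r ≢ 0ℚ → p ℚ.* r ≡ q ℚ.* r → p ≡ q
*-cancelʳ-≢0 p q {r} r≢0 pr≡qr = begin
  p                   ≡⟨ undo p ⟨
  p ℚ.* r ℚ.* 1/r     ≡⟨ cong (ℚ._* 1/r) pr≡qr ⟩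
  q ℚ.* r ℚ.* 1/r     ≡⟨ undo q ⟩
  q                   ∎
  where
  open ≡-Reasoning
  1/r = ℚ.1/_ r {{ℚ.≢-nonZero r≢0}}
  undo : ∀ p → p ℚ.* r ℚ.* 1/r ≡ p
  undo p = trans (ℚ.*-assoc p r 1/r)
    (trans (cong (p ℚ.*_) (ℚ.*-inverseʳ r {{ℚ.≢-nonZero r≢0}})) (ℚ.*-identityʳ p))

÷-unique : ∀ {p q r} (q≢0 : q ≢ 0ℚ) → r ℚ.* q ≡ p → p ÷ q by q≢0 ≡ r
÷-unique {p} {q} q≢0 rq≡p = *-cancelʳ-≢0 _ _ q≢0 (trans (÷-* p q q≢0) (sym rq≡p))

opaque
  fraction : ℕ → ℕ → ℕ → ℚ
  fraction a b c = (⟪ a ⟫ ℚ.- ⟪ b ⟫) ÷ ⟪ suc c ⟫ by ⟪suc⟫≢0 c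

  fraction-division : ∀ a b c →
    Graph division (⟪ a ⟫ ℚ.- ⟪ b ⟫ ∷ ⟪ suc c ⟫ ∷ []) (fraction a b c)
  fraction-division a b c = ⟪suc⟫≢0 c , refl

  fraction-* : ∀ a b c → fraction a b c ℚ.* ⟪ suc c ⟫ ≡ ⟪ a ⟫ ℚ.- ⟪ b ⟫
  fraction-* a b c = ÷-* (⟪ a ⟫ ℚ.- ⟪ b ⟫) ⟪ suc c ⟫ (⟪suc⟫≢0 c)

  fraction-unique : ∀ {a b c q} → q ℚ.* ⟪ suc c ⟫ ≡ ⟪ a ⟫ ℚ.- ⟪ b ⟫ → fraction a b c ≡ q
  fraction-unique {c = c} = ÷-unique (⟪suc⟫≢0 c)

module _ (a b c a′ b′ c′ : ℕ) where
  private
    p  = fraction a b c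
    p′ = fraction a′ b′ c′
    A  = ⟪ a ⟫
    B  = ⟪ b ⟫
    D  = ⟪ suc c ⟫
    A′ = ⟪ a′ ⟫
    B′ = ⟪ b′ ⟫
    D′ = ⟪ suc c′ ⟫

  -- The new denominator is 1 + (c + c′ (1 + c)) = (1 + c′)(1 + c).
  fraction-+ : fraction (a * suc c′ + a′ * suc c) (b * suc c′ + b′ * suc c) (c + c′ * suc c) ≡
               p ℚ.+ p′
  fraction-+ = fraction-unique (begin
    (p ℚ.+ p′) ℚ.* ⟪ suc c′ * suc c ⟫
      ≡⟨ cong ((p ℚ.+ p′) ℚ.*_) (⟪⟫-* (suc c′) (suc c)) ⟩
    (p ℚ.+ p′) ℚ.* (D′ ℚ.* D)
      ≡⟨ solve 4 (λ p p′ D D′ → (p :+ p′) :* (D′ :* D) := p :* D :* D′ :+ p′ :* D′ :* D)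
           refl p p′ D D′ ⟩
    p ℚ.* D ℚ.* D′ ℚ.+ p′ ℚ.* D′ ℚ.* D
      ≡⟨ cong₂ (λ x y → x ℚ.* D′ ℚ.+ y ℚ.* D) (fraction-* a b c) (fraction-* a′ b′ c′) ⟩
    (A ℚ.- B) ℚ.* D′ ℚ.+ (A′ ℚ.- B′) ℚ.* D
      ≡⟨ solve 6 (λ A B A′ B′ D D′ → (A :- B) :* D′ :+ (A′ :- B′) :* D :=
           A :* D′ :+ A′ :* D :- (B :* D′ :+ B′ :* D)) refl A B A′ B′ D D′ ⟩
    A ℚ.* D′ ℚ.+ A′ ℚ.* D ℚ.- (B ℚ.* D′ ℚ.+ B′ ℚ.* D)
      ≡⟨ cong₂ ℚ._-_ (⟪⟫-+* a (suc c′) a′ (suc c)) (⟪⟫-+* b (suc c′) b′ (suc c)) ⟨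
    ⟪ a * suc c′ + a′ * suc c ⟫ ℚ.- ⟪ b * suc c′ + b′ * suc c ⟫ ∎)
    where
    open ≡-Reasoning
    open ℚ-Solver

  fraction-× : fraction (a * a′ + b * b′) (a * b′ + b * a′) (c + c′ * suc c) ≡ p ℚ.* p′
  fraction-× = fraction-unique (begin
    (p ℚ.* p′) ℚ.* ⟪ suc c′ * suc c ⟫
      ≡⟨ cong ((p ℚ.* p′) ℚ.*_) (⟪⟫-* (suc c′) (suc c)) ⟩
    (p ℚ.* p′) ℚ.* (D′ ℚ.* D)
      ≡⟨ solve 4 (λ p p′ D D′ → (p :* p′) :* (D′ :* D) := (p :* D) :* (p′ :* D′))
           refl p p′ D D′ ⟩
    (p ℚ.* D) ℚ.* (p′ ℚ.* D′)
      ≡⟨ cong₂ ℚ._*_ (fraction-* a b c) (fraction-* a′ b′ c′) ⟩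
    (A ℚ.- B) ℚ.* (A′ ℚ.- B′)
      ≡⟨ solve 4 (λ A B A′ B′ → (A :- B) :* (A′ :- B′) :=
           A :* A′ :+ B :* B′ :- (A :* B′ :+ B :* A′)) refl A B A′ B′ ⟩
    A ℚ.* A′ ℚ.+ B ℚ.* B′ ℚ.- (A ℚ.* B′ ℚ.+ B ℚ.* A′)
      ≡⟨ cong₂ ℚ._-_ (⟪⟫-+* a a′ b b′) (⟪⟫-+* a b′ b a′) ⟨
    ⟪ a * a′ + b * b′ ⟫ ℚ.- ⟪ a * b′ + b * a′ ⟫ ∎)
    where
    open ≡-Reasoning
    open ℚ-Solver

  private
    cross : (p ℚ.- p′) ℚ.* (D ℚ.* D′) ≡
            ⟪ a * suc c′ + b′ * suc c ⟫ ℚ.- ⟪ a′ * suc c + b * suc c′ ⟫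
    cross = begin
      (p ℚ.- p′) ℚ.* (D ℚ.* D′)
        ≡⟨ solve 4 (λ p p′ D D′ → (p :- p′) :* (D :* D′) := p :* D :* D′ :- p′ :* D′ :* D)
             refl p p′ D D′ ⟩
      p ℚ.* D ℚ.* D′ ℚ.- p′ ℚ.* D′ ℚ.* D
        ≡⟨ cong₂ (λ x y → x ℚ.* D′ ℚ.- y ℚ.* D) (fraction-* a b c) (fraction-* a′ b′ c′) ⟩
      (A ℚ.- B) ℚ.* D′ ℚ.- (A′ ℚ.- B′) ℚ.* D
        ≡⟨ solve 6 (λ A B A′ B′ D D′ → (A :- B) :* D′ :- (A′ :- B′) :* D :=
             A :* D′ :+ B′ :* D :- (A′ :* D :+ B :* D′)) refl A B A′ B′ D D′ ⟩
      A ℚ.* D′ ℚ.+ B′ ℚ.* D ℚ.- (A′ ℚ.* D ℚ.+ B ℚ.* D′)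
        ≡⟨ cong₂ ℚ._-_ (⟪⟫-+* a (suc c′) b′ (suc c)) (⟪⟫-+* a′ (suc c) b (suc c′)) ⟨
      ⟪ a * suc c′ + b′ * suc c ⟫ ℚ.- ⟪ a′ * suc c + b * suc c′ ⟫ ∎
      where
      open ≡-Reasoning
      open ℚ-Solver

  fraction-≡⇒ : p ≡ p′ → a * suc c′ + b′ * suc c ≡ a′ * suc c + b * suc c′
  fraction-≡⇒ p≡p′ = ⟪⟫-injective _ _ (ℚ-x-y≡0⇒x≡y _ _ (trans (sym cross)
    (trans (cong (λ q → (q ℚ.- p′) ℚ.* (D ℚ.* D′)) p≡p′)
      (trans (cong (ℚ._* (D ℚ.* D′)) (ℚ.+-inverseʳ p′)) (ℚ.*-zeroˡ (D ℚ.* D′))))))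

  ≡⇒fraction-≡ : a * suc c′ + b′ * suc c ≡ a′ * suc c + b * suc c′ → p ≡ p′
  ≡⇒fraction-≡ eq = ℚ-x-y≡0⇒x≡y p p′
    (*-cancelʳ-≢0 _ _ (⟪suc⟫≢0 c) (*-cancelʳ-≢0 _ _ (⟪suc⟫≢0 c′) (begin
      (p ℚ.- p′) ℚ.* D ℚ.* D′          ≡⟨ ℚ.*-assoc (p ℚ.- p′) D D′ ⟩
      (p ℚ.- p′) ℚ.* (D ℚ.* D′)        ≡⟨ cross ⟩
      ⟪ a * suc c′ + b′ * suc c ⟫ ℚ.- ⟪ rhs ⟫
        ≡⟨ cong (λ k → ⟪ k ⟫ ℚ.- ⟪ rhs ⟫) eq ⟩
      ⟪ rhs ⟫ ℚ.- ⟪ rhs ⟫               ≡⟨ ℚ.+-inverseʳ ⟪ rhs ⟫ ⟩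
      0ℚ
        ≡⟨ trans (cong (ℚ._* D′) (ℚ.*-zeroˡ D)) (ℚ.*-zeroˡ D′) ⟨
      0ℚ ℚ.* D ℚ.* D′                   ∎)))
    where
    open ≡-Reasoning
    rhs = a′ * suc c + b * suc c′

fraction-neg : ∀ a b c → fraction b a c ≡ ℚ.- fraction a b c
fraction-neg a b c = fraction-unique (begin
  (ℚ.- fraction a b c) ℚ.* ⟪ suc c ⟫    ≡⟨ ℚ.neg-distribˡ-* (fraction a b c) ⟪ suc c ⟫ ⟨
  ℚ.- (fraction a b c ℚ.* ⟪ suc c ⟫)    ≡⟨ cong ℚ.-_ (fraction-* a b c) ⟩
  ℚ.- (⟪ a ⟫ ℚ.- ⟪ b ⟫)
    ≡⟨ solve 2 (λ A B → :- (A :- B) := B :- A) refl ⟪ a ⟫ ⟪ b ⟫ ⟩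
  ⟪ b ⟫ ℚ.- ⟪ a ⟫                       ∎)
  where
  open ≡-Reasoning
  open ℚ-Solver

distance-≡0 : ∀ m n → distance m n ≡ 0 → m ≡ n
distance-≡0 m n eq = ≤-antisym (m∸n≡0⇒m≤n (m+n≡0⇒m≡0 (m ∸ n) eq))
                               (m∸n≡0⇒m≤n (m+n≡0⇒n≡0 (m ∸ n) eq))

distance-refl : ∀ n → distance n n ≡ 0
distance-refl n = cong₂ _+_ (n∸n≡0 n) (n∸n≡0 n)

⟪distance⟫² : ∀ m n → ⟪ distance m n * distance m n ⟫ ≡
              (⟪ m ⟫ ℚ.- ⟪ n ⟫) ℚ.* (⟪ m ⟫ ℚ.- ⟪ n ⟫)
⟪distance⟫² m n with ≤-total m n
... | inj₁ m≤n = begin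
  ⟪ distance m n * distance m n ⟫    ≡⟨ cong (λ k → ⟪ (k + (n ∸ m)) * (k + (n ∸ m)) ⟫) (m≤n⇒m∸n≡0 m≤n) ⟩
  ⟪ (n ∸ m) * (n ∸ m) ⟫              ≡⟨ ⟪⟫-* (n ∸ m) (n ∸ m) ⟩
  E ℚ.* E
    ≡⟨ solve 2 (λ E M → E :* E := (M :- (E :+ M)) :* (M :- (E :+ M))) refl E M ⟩
  (M ℚ.- (E ℚ.+ M)) ℚ.* (M ℚ.- (E ℚ.+ M))
    ≡⟨ cong (λ x → (M ℚ.- x) ℚ.* (M ℚ.- x)) N≡ ⟨
  (M ℚ.- N) ℚ.* (M ℚ.- N)            ∎
  where
  open ≡-Reasoning
  open ℚ-Solver
  M = ⟪ m ⟫
  N = ⟪ n ⟫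
  E = ⟪ n ∸ m ⟫
  N≡ : N ≡ E ℚ.+ M
  N≡ = trans (cong ⟪_⟫ (sym (m∸n+n≡m m≤n))) (⟪⟫-+ (n ∸ m) m)
... | inj₂ n≤m = begin
  ⟪ distance m n * distance m n ⟫    ≡⟨ cong (λ k → ⟪ k * k ⟫) d≡ ⟩
  ⟪ (m ∸ n) * (m ∸ n) ⟫              ≡⟨ ⟪⟫-* (m ∸ n) (m ∸ n) ⟩
  E ℚ.* E
    ≡⟨ solve 2 (λ E N → E :* E := (E :+ N :- N) :* (E :+ N :- N)) refl E N ⟩
  (E ℚ.+ N ℚ.- N) ℚ.* (E ℚ.+ N ℚ.- N)
    ≡⟨ cong (λ x → (x ℚ.- N) ℚ.* (x ℚ.- N)) M≡ ⟨
  (M ℚ.- N) ℚ.* (M ℚ.- N)            ∎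
  where
  open ≡-Reasoning
  open ℚ-Solver
  M = ⟪ m ⟫
  N = ⟪ n ⟫
  E = ⟪ m ∸ n ⟫
  d≡ : distance m n ≡ m ∸ n
  d≡ = trans (cong ((m ∸ n) +_) (m≤n⇒m∸n≡0 n≤m)) (+-identityʳ (m ∸ n))
  M≡ : M ≡ E ℚ.+ N
  M≡ = trans (cong ⟪_⟫ (sym (m∸n+n≡m n≤m))) (⟪⟫-+ (m ∸ n) n)

-- 1 / ((a − b) / D) = D (a − b) / (a − b)²
fraction-inverse : ∀ a b c → fraction a b c ≢ 0ℚ →
  fraction (suc c * a) (suc c * b) (pred (distance a b * distance a b)) ℚ.* fraction a b c ≡ 1ℚ
fraction-inverse a b c p≢0 =
  trans (cong (ℚ._* p) (fraction-unique {q = 1/p} (begin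
    1/p ℚ.* ⟪ suc (pred d²) ⟫              ≡⟨ cong (λ k → 1/p ℚ.* ⟪ k ⟫) (suc-pred d² {{d²≢0}}) ⟩
    1/p ℚ.* ⟪ d² ⟫                         ≡⟨ cong (1/p ℚ.*_) (⟪distance⟫² a b) ⟩
    1/p ℚ.* ((A ℚ.- B) ℚ.* (A ℚ.- B))
      ≡⟨ cong (λ x → 1/p ℚ.* (x ℚ.* (A ℚ.- B))) (fraction-* a b c) ⟨
    1/p ℚ.* (p ℚ.* D ℚ.* (A ℚ.- B))
      ≡⟨ solve 5 (λ q p D A B → q :* (p :* D :* (A :- B)) := q :* p :* (D :* A :- D :* B))
           refl 1/p p D A B ⟩
    1/p ℚ.* p ℚ.* (D ℚ.* A ℚ.- D ℚ.* B)    ≡⟨ cong (ℚ._* (D ℚ.* A ℚ.- D ℚ.* B)) (÷-* 1ℚ p p≢0) ⟩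
    1ℚ ℚ.* (D ℚ.* A ℚ.- D ℚ.* B)           ≡⟨ ℚ.*-identityˡ (D ℚ.* A ℚ.- D ℚ.* B) ⟩
    D ℚ.* A ℚ.- D ℚ.* B                    ≡⟨ cong₂ ℚ._-_ (⟪⟫-* (suc c) a) (⟪⟫-* (suc c) b) ⟨
    ⟪ suc c * a ⟫ ℚ.- ⟪ suc c * b ⟫        ∎)))
  (÷-* 1ℚ p p≢0)
  where
  open ≡-Reasoning
  open ℚ-Solver
  A = ⟪ a ⟫
  B = ⟪ b ⟫
  D = ⟪ suc c ⟫
  p = fraction a b c
  1/p = 1ℚ ÷ p by p≢0
  d² = distance a b * distance a b
  p≡0 : d² ≡ 0 → p ≡ 0ℚ
  p≡0 d²≡0 with refl ← distance-≡0 a b (reduce (m*n≡0⇒m≡0∨n≡0 (distance a b) d²≡0)) =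
    fraction-unique (trans (ℚ.*-zeroˡ D) (sym (ℚ.+-inverseʳ A)))
  d²≢0 : NonZero d²
  d²≢0 = ≢-nonZero (p≢0 ∘ p≡0)

⟪⟫-≃ : ∀ k → ℚ.toℚᵘ ⟪ k ⟫ ℚᵘ.≃ ℚᵘ.mkℚᵘ (ℤ.+ k) 0
⟪⟫-≃ zero    = ℚᵘ.*≡* refl
⟪⟫-≃ (suc k) = ℚᵘ.≃-trans (ℚ.toℚᵘ-homo-+ ⟪ k ⟫ 1ℚ) (ℚᵘ.≃-trans (ℚᵘ.+-congˡ _ (⟪⟫-≃ k))
  (ℚᵘ.*≡* (ℤ-Solver.solve 1
    (λ k → (k :* con (ℤ.+ 1) :+ con (ℤ.+ 1)) :* con (ℤ.+ 1) := (con (ℤ.+ 1) :+ k) :* con (ℤ.+ 1))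
    refl (ℤ.+ k))))
  where open ℤ-Solver

fraction-surjective : ∀ q → ∃[ a ] ∃[ b ] ∃[ c ] fraction a b c ≡ q
fraction-surjective q@(ℚ.mkℚ (ℤ.+ a) d _) = a , 0 , d , fraction-unique (trans
  (ℚ.toℚᵘ-injective (begin
    ℚ.toℚᵘ (q ℚ.* ⟪ suc d ⟫)                     ≈⟨ ℚ.toℚᵘ-homo-* q ⟪ suc d ⟫ ⟩
    ℚ.toℚᵘ q ℚᵘ.* ℚ.toℚᵘ ⟪ suc d ⟫               ≈⟨ ℚᵘ.*-congˡ (⟪⟫-≃ (suc d)) ⟩
    ℚᵘ.mkℚᵘ (ℤ.+ a) d ℚᵘ.* ℚᵘ.mkℚᵘ (ℤ.+ suc d) 0
      ≈⟨ ℚᵘ.*≡* (solve 2 (λ a d → (a :* d) :* con (ℤ.+ 1) := a :* (d :* con (ℤ.+ 1)))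
           refl (ℤ.+ a) (ℤ.+ suc d)) ⟩
    ℚᵘ.mkℚᵘ (ℤ.+ a) 0                            ≈⟨ ⟪⟫-≃ a ⟨
    ℚ.toℚᵘ ⟪ a ⟫                                 ∎))
  (sym (ℚ.+-identityʳ ⟪ a ⟫)))
  where
  open ℚᵘ.≃-Reasoning
  open ℤ-Solver
fraction-surjective (ℚ.mkℚ ℤ.-[1+ a ] d cop) with fraction-surjective (ℚ.mkℚ ℤ.+[1+ a ] d cop)
... | a′ , b , c , eq = b , a′ , c , trans (fraction-neg a′ b c) (cong ℚ.-_ eq)

numerator⁺ numerator⁻ denominator-1 : ℕ → ℕ
numerator⁺    n = left n
numerator⁻    n = left (right n)
denominator-1 n = right (right n)

triple : ℕ → ℕ → ℕ → ℕ
triple a b c = pair a (pair b c)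

value : ℕ → ℚ
value n = fraction (numerator⁺ n) (numerator⁻ n) (denominator-1 n)

value-triple : ∀ a b c → value (triple a b c) ≡ fraction a b c
value-triple a b c = fraction-cong (left-pair a (pair b c))
  (trans (cong left snd) (left-pair b c)) (trans (cong right snd) (right-pair b c))
  where
  snd : right (triple a b c) ≡ pair b c
  snd = right-pair a (pair b c)
  fraction-cong : ∀ {a a′ b b′ c c′} → a ≡ a′ → b ≡ b′ → c ≡ c′ →
                  fraction a b c ≡ fraction a′ b′ c′
  fraction-cong refl refl refl = refl

value-surjective : ∀ q → ∃[ n ] value n ≡ q
value-surjective q with a , b , c , eq ← fraction-surjective q =
  triple a b c , trans (value-triple a b c) eq

numerator⁺ᶜ numerator⁻ᶜ denominator-1ᶜ denominatorᶜ : TotalRec n → TotalRec n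
numerator⁺ᶜ    f = leftᶜ ⟨ f ∷ [] ⟩
numerator⁻ᶜ    f = leftᶜ ⟨ rightᶜ ⟨ f ∷ [] ⟩ ∷ [] ⟩
denominator-1ᶜ f = rightᶜ ⟨ rightᶜ ⟨ f ∷ [] ⟩ ∷ [] ⟩
denominatorᶜ   f = successor ⟨ denominator-1ᶜ f ∷ [] ⟩

tripleᶜ : TotalRec n → TotalRec n → TotalRec n → TotalRec n
tripleᶜ f g h = pairᶜ ⟨ f ∷ pairᶜ ⟨ g ∷ h ∷ [] ⟩ ∷ [] ⟩

module _ {n} (f g : TotalRec n) where
  private
    a  = numerator⁺ᶜ f
    b  = numerator⁻ᶜ f
    c  = denominator-1ᶜ f
    d  = denominatorᶜ f
    a′ = numerator⁺ᶜ g
    b′ = numerator⁻ᶜ g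
    c′ = denominator-1ᶜ g
    d′ = denominatorᶜ g

  addᶜ : TotalRec n
  addᶜ = tripleᶜ (a ⊗ d′ ⊕ a′ ⊗ d) (b ⊗ d′ ⊕ b′ ⊗ d) (c ⊕ c′ ⊗ d)

  value-add : ∀ xs → value (eval addᶜ xs) ≡ value (eval f xs) ℚ.+ value (eval g xs)
  value-add xs = trans (value-triple _ _ _) (fraction-+
    (eval a xs) (eval b xs) (eval c xs) (eval a′ xs) (eval b′ xs) (eval c′ xs))

  multiplyᶜ : TotalRec n
  multiplyᶜ = tripleᶜ (a ⊗ a′ ⊕ b ⊗ b′) (a ⊗ b′ ⊕ b ⊗ a′) (c ⊕ c′ ⊗ d)

  value-multiply : ∀ xs → value (eval multiplyᶜ xs) ≡ value (eval f xs) ℚ.* value (eval g xs)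
  value-multiply xs = trans (value-triple _ _ _) (fraction-×
    (eval a xs) (eval b xs) (eval c xs) (eval a′ xs) (eval b′ xs) (eval c′ xs))

  equalᶜ : TotalRec n
  equalᶜ = constant 1 ⊖ distanceᶜ (a ⊗ d′ ⊕ b′ ⊗ d) (a′ ⊗ d ⊕ b ⊗ d′)

  equalᶜ-≡ : ∀ xs → value (eval f xs) ≡ value (eval g xs) → eval equalᶜ xs ≡ 1
  equalᶜ-≡ xs eq = cong (1 ∸_) (trans
    (cong (λ k → distance k (eval (a′ ⊗ d ⊕ b ⊗ d′) xs)) (fraction-≡⇒
      (eval a xs) (eval b xs) (eval c xs) (eval a′ xs) (eval b′ xs) (eval c′ xs) eq))
    (distance-refl (eval (a′ ⊗ d ⊕ b ⊗ d′) xs)))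

  equalᶜ-≢ : ∀ xs → value (eval f xs) ≢ value (eval g xs) → eval equalᶜ xs ≡ 0
  equalᶜ-≢ xs neq = m≤n⇒m∸n≡0 (n≢0⇒n>0 λ eq → neq (≡⇒fraction-≡
    (eval a xs) (eval b xs) (eval c xs) (eval a′ xs) (eval b′ xs) (eval c′ xs)
    (distance-≡0 (eval (a ⊗ d′ ⊕ b′ ⊗ d) xs) (eval (a′ ⊗ d ⊕ b ⊗ d′) xs) eq)))

module _ {n} (f : TotalRec n) where
  private
    a = numerator⁺ᶜ f
    b = numerator⁻ᶜ f
    c = denominator-1ᶜ f
    d = denominatorᶜ f

  negateᶜ : TotalRec n
  negateᶜ = tripleᶜ b a c

  value-negate : ∀ xs → value (eval negateᶜ xs) ≡ ℚ.- value (eval f xs)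
  value-negate xs = trans (value-triple _ _ _) (fraction-neg (eval a xs) (eval b xs) (eval c xs))

  invertᶜ : TotalRec n
  invertᶜ = tripleᶜ (d ⊗ a) (d ⊗ b) (predecessor ⟨ distanceᶜ a b ⊗ distanceᶜ a b ∷ [] ⟩)

  value-invert : ∀ xs → value (eval f xs) ≢ 0ℚ →
                 value (eval invertᶜ xs) ℚ.* value (eval f xs) ≡ 1ℚ
  value-invert xs neq = trans (cong (ℚ._* value (eval f xs)) (value-triple _ _ _))
    (fraction-inverse (eval a xs) (eval b xs) (eval c xs) neq)

module _ {n} (f g : TotalRec n) where

  subtractᶜ : TotalRec n
  subtractᶜ = addᶜ f (negateᶜ g)

  value-subtract : ∀ xs → value (eval subtractᶜ xs) ≡ value (eval f xs) ℚ.- value (eval g xs)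
  value-subtract xs =
    trans (value-add f (negateᶜ g) xs) (cong (value (eval f xs) ℚ.+_) (value-negate g xs))

  divideᶜ : TotalRec n
  divideᶜ = multiplyᶜ f (invertᶜ g)

  value-divide : ∀ xs (≢0 : value (eval g xs) ≢ 0ℚ) →
                 value (eval f xs) ÷ value (eval g xs) by ≢0 ≡ value (eval divideᶜ xs)
  value-divide xs ≢0 = ÷-unique ≢0 (begin
    value (eval divideᶜ xs) ℚ.* q            ≡⟨ cong (ℚ._* q) (value-multiply f (invertᶜ g) xs) ⟩
    p ℚ.* value (eval (invertᶜ g) xs) ℚ.* q   ≡⟨ ℚ.*-assoc p _ q ⟩
    p ℚ.* (value (eval (invertᶜ g) xs) ℚ.* q) ≡⟨ cong (p ℚ.*_) (value-invert g xs ≢0) ⟩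
    p ℚ.* 1ℚ                                  ≡⟨ ℚ.*-identityʳ p ⟩
    p                                         ∎)
    where
    open ≡-Reasoning
    p = value (eval f xs)
    q = value (eval g xs)

equality : TotalRec 2
equality = equalᶜ x₀ x₁

equality-≡ : ∀ x y → value x ≡ value y → codeOf equality [ x ∷ y ∷ [] ]⇓ 1
equality-≡ x y eq = subst (codeOf equality [ x ∷ y ∷ [] ]⇓_)
  (equalᶜ-≡ x₀ x₁ (x ∷ y ∷ []) eq) (evaluates equality (x ∷ y ∷ []))

equality-≢ : ∀ x y → value x ≢ value y → codeOf equality [ x ∷ y ∷ [] ]⇓ 0
equality-≢ x y neq = subst (codeOf equality [ x ∷ y ∷ [] ]⇓_)
  (equalᶜ-≢ x₀ x₁ (x ∷ y ∷ []) neq) (evaluates equality (x ∷ y ∷ []))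

standard : ℕ ⇀ ℚ
standard = total value

standard-tracks : ∀ {op : Vec ℚ 2 ⇀ ℚ} (f : TotalRec 2) →
  (∀ x y {e} → Graph op (value x ∷ value y ∷ []) e → value (eval f (x ∷ y ∷ [])) ≡ e) →
  ComputableRelativelyTo standard op
standard-tracks f correct .ComputableRelativelyTo.ôp .code = codeOf f
standard-tracks f correct .ComputableRelativelyTo.ôp .maps {xs} _ =
  eval f xs , evaluates f xs , _ , refl
standard-tracks f correct .ComputableRelativelyTo.tracks {x ∷ y ∷ []} (refl ∷ refl ∷ []) op-xy run =
  trans (cong value (⇓-deterministic run (evaluates f (x ∷ y ∷ [])))) (correct x y op-xy)

standard-isIndexing : IsIndexing standard
standard-isIndexing .IsIndexing.enumerable = inj₂
  ( record { code = proj zero ; maps = λ _ → _ , proj⇓ , _ }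
  , λ y → mk⇔ (λ _ → y , proj⇓) (λ _ → value y , refl))
standard-isIndexing .IsIndexing.surjective = value-surjective
standard-isIndexing .IsIndexing.eq .code = codeOf equality
standard-isIndexing .IsIndexing.eq .maps {x ∷ y ∷ []} _ with value x ℚ.≟ value y
... | yes eq = 1 , equality-≡ x y eq , inj₂ refl
... | no neq = 0 , equality-≢ x y neq , inj₁ refl
standard-isIndexing .IsIndexing.eq-≡ {x} {y} refl refl = equality-≡ x y
standard-isIndexing .IsIndexing.eq-≢ {x} {y} refl refl = equality-≢ x y

standard-isAdmissible : IsAdmissible ℚ⟨+-×/⟩ standard
standard-isAdmissible .IsAdmissible.isIndexing = standard-isIndexing
standard-isAdmissible .IsAdmissible.computable =
    standard-tracks (addᶜ x₀ x₁) (λ x y → trans (value-add x₀ x₁ (x ∷ y ∷ [])))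
  ∷ standard-tracks (subtractᶜ x₀ x₁) (λ x y → trans (value-subtract x₀ x₁ (x ∷ y ∷ [])))
  ∷ standard-tracks (multiplyᶜ x₀ x₁) (λ x y → trans (value-multiply x₀ x₁ (x ∷ y ∷ [])))
  ∷ standard-tracks (divideᶜ x₀ x₁) (λ { x y (≢0 , eq) →
      trans (sym (value-divide x₀ x₁ (x ∷ y ∷ []) ≢0)) eq })
  ∷ []

least : ∀ {P : ℕ → Set} → Decidable P → ∀ n → P n → ∃[ m ] (P m × (∀ k → k < m → ¬ P k))
least P? zero    p = 0 , p , λ _ ()
least P? (suc n) p with P? 0
... | yes p₀ = 0 , p₀ , λ _ ()
... | no ¬p₀ with m , pₘ , below ← least (P? ∘ suc) n p =
  suc m , pₘ , λ { zero _ → ¬p₀ ; (suc k) (s≤s k<m) → below k k<m }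

module Admissible {j : ℕ ⇀ ℚ} (j-admissible : IsAdmissible ℚ⟨+-×/⟩ j) where
  open IsAdmissible j-admissible
  open IsIndexing isIndexing

  Names : Rec n → Vec ℕ n → ℚ → Set
  Names c xs e = ∃[ y ] (c [ xs ]⇓ y × Graph j y e)

  apply : {op : Vec ℚ 2 ⇀ ℚ} → ComputableRelativelyTo j op → Rec n → Rec n → Rec n
  apply op^ f g = comp (code (ComputableRelativelyTo.ôp op^)) (f ∷ g ∷ [])

  apply-names : ∀ {op : Vec ℚ 2 ⇀ ℚ} (op^ : ComputableRelativelyTo j op) {f g : Rec n} {xs p q e} →
                Names f xs p → Names g xs q → Graph op (p ∷ q ∷ []) e → Names (apply op^ f g) xs e
  apply-names op^ (x , f⇓x , x↦p) (y , g⇓y , y↦q) op-pq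
    with z , run , _ ← maps (ComputableRelativelyTo.ôp op^) ((_ , x↦p) ∷ (_ , y↦q) ∷ []) =
    z , comp⇓ (f⇓x ∷ g⇓y ∷ []) run ,
    ComputableRelativelyTo.tracks op^ (x↦p ∷ y↦q ∷ []) op-pq run

  name : ℚ → Rec n
  name q = codeOf (constant (proj₁ (surjective q)))

  name-names : ∀ q {xs : Vec ℕ n} → Names (name q) xs q
  name-names q = _ , evaluates (constant (proj₁ (surjective q))) _ , proj₂ (surjective q)

  private
    +^ : ComputableRelativelyTo j (binary ℚ._+_)
    +^ = List.head computable

    -^ : ComputableRelativelyTo j (binary ℚ._-_)
    -^ = List.head (List.tail computable)

    ÷^ : ComputableRelativelyTo j division
    ÷^ = List.head (List.tail (List.tail (List.tail computable)))

  numeral : Rec 1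
  numeral = prec (name 0ℚ) (apply +^ (proj (suc zero)) (name 1ℚ))

  numeral-names : ∀ k → Names numeral (k ∷ []) ⟪ k ⟫
  numeral-names zero with y , run , y↦0 ← name-names 0ℚ = y , precᶻ⇓ run , y↦0
  numeral-names (suc k)
    with y , run , y↦k ← numeral-names k
    with z , run′ , z↦k+1 ← apply-names +^ {proj (suc zero)} {xs = k ∷ y ∷ []}
                              (y , proj⇓ , y↦k) (name-names 1ℚ) refl =
    z , precˢ⇓ run run′ , z↦k+1

  numeral∘ : TotalRec n → Rec n
  numeral∘ f = comp numeral (codeOf f ∷ [])

  numeral∘-names : ∀ (f : TotalRec n) xs → Names (numeral∘ f) xs ⟪ eval f xs ⟫
  numeral∘-names f xs with y , run , y↦k ← numeral-names (eval f xs) =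
    y , comp⇓ (evaluates f xs ∷ []) run , y↦k

  fromStandard : TotalRec n → Rec n
  fromStandard f =
    apply ÷^ (apply -^ (numeral∘ (numerator⁺ᶜ f)) (numeral∘ (numerator⁻ᶜ f)))
             (numeral∘ (denominatorᶜ f))

  fromStandard-names : ∀ (f : TotalRec n) xs → Names (fromStandard f) xs (value (eval f xs))
  fromStandard-names f xs = apply-names ÷^
    (apply-names -^ (numeral∘-names (numerator⁺ᶜ f) xs) (numeral∘-names (numerator⁻ᶜ f) xs) refl)
    (numeral∘-names (denominatorᶜ f) xs)
    (fraction-division (eval (numerator⁺ᶜ f) xs) (eval (numerator⁻ᶜ f) xs)
                       (eval (denominator-1ᶜ f) xs))

  mismatch : Rec 2
  mismatch = comp (codeOf {1} (constant 1 ⊖ x₀))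
                  (comp (code eq) (proj (suc zero) ∷ fromStandard x₀ ∷ []) ∷ [])

  mismatch-≡ : ∀ {x e} n → Graph j x e → value n ≡ e → mismatch [ n ∷ x ∷ [] ]⇓ 0
  mismatch-≡ {x} n x↦e eq with y , run , y↦n ← fromStandard-names x₀ (n ∷ x ∷ []) =
    comp⇓ (comp⇓ (proj⇓ ∷ run ∷ []) (eq-≡ x↦e y↦n (sym eq)) ∷ [])
          (evaluates (constant 1 ⊖ x₀) (1 ∷ []))

  mismatch-≢ : ∀ {x e} n → Graph j x e → value n ≢ e → mismatch [ n ∷ x ∷ [] ]⇓ 1
  mismatch-≢ {x} n x↦e neq with y , run , y↦n ← fromStandard-names x₀ (n ∷ x ∷ []) =
    comp⇓ (comp⇓ (proj⇓ ∷ run ∷ []) (eq-≢ x↦e y↦n (≢-sym neq)) ∷ [])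
          (evaluates (constant 1 ⊖ x₀) (0 ∷ []))

  toStandard : Rec 1
  toStandard = μ mismatch

  toStandard-finds : ∀ {x e} → Graph j x e → ∃[ n ] (toStandard [ x ∷ [] ]⇓ n × value n ≡ e)
  toStandard-finds {e = e} x↦e
    with n , eq ← value-surjective e
    with m , eqₘ , below ← least (λ k → value k ℚ.≟ e) n eq =
    m , μ⇓ (λ k k<m → 0 , mismatch-≢ k x↦e (below k k<m)) (mismatch-≡ m x↦e eqₘ) , eqₘ

reducible : ∀ {j j′} → IsAdmissible ℚ⟨+-×/⟩ j → IsAdmissible ℚ⟨+-×/⟩ j′ → j′ ReducesTo j
reducible {j} {j′} j-admissible j′-admissible = h , correct
  where
  module J  = Admissible j-admissible
  module J′ = Admissible j′-admissible

  h-code : Rec 1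
  h-code = comp (J.fromStandard x₀) (J′.toStandard ∷ [])

  h-names : ∀ {x e} → Graph j′ x e → J.Names h-code (x ∷ []) e
  h-names x↦e with n , run , refl ← J′.toStandard-finds x↦e
    with y , run′ , y↦e ← J.fromStandard-names x₀ (n ∷ []) =
    y , comp⇓ (run ∷ []) run′ , y↦e

  h : Computable (Dom j′ ^ 1) (Dom j)
  h .code = h-code
  h .maps ((e , x↦e) ∷ []) with y , run , y↦e ← h-names x↦e = y , run , e , y↦e

  correct : ∀ {x y e} → Graph j′ x e → h-code [ x ∷ [] ]⇓ y → Graph j y e
  correct x↦e run with z , run′ , z↦e ← h-names x↦e =
    subst (λ y → Graph j y _) (⇓-deterministic run′ run) z↦e

proposition5 : ComputabilityStable ℚ⟨+-×/⟩
proposition5 = (standard , standard-isAdmissible) , λ _ _ → reducible
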